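{- A graph on $n$ vertices requires exactly $n-1$ edge reflections to become an edgeless graph (that is, $n-1$ is the minimum number of edge reflections that transforms it into the edgeless graph on the same vertex set) if and only if it is a tree.
   Context: All graphs are finite and simple, with at least one vertex; $N(u)$ denotes the (open) neighborhood of $u$. An edge reflection $t_{uv}^X$ on a graph $G$ consists of choosing two vertices $u,v$ with $uv\in E(G)$, choosing a subset $X\subseteq N(u)\cup N(v)$ containing $u$ and $v$, and then toggling all edges between $\{u,v\}$ and $X$: that is, the edge $uv$ is deleted, and for every $w\in X\setminus\{u,v\}$ each of the pairs $uw$ and $vw$ is changed from edge to nonedge or from nonedge to edge. Reflections are applied successively, each to the graph resulting from the previous one. -}

module Defs where

open import Data.Bool using (Bool; false; T; _xor_)
open import Data.Fin using (Fin; _≟_)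
open import Data.Fin.Subset using (Subset; _∈_; _⊆_; _∪_)
open import Data.Fin.Subset.Properties using (_∈?_)
open import Data.List using (_∷_; _∷ʳ_; List; length)
open import Data.List.Relation.Unary.Linked using (Linked)
open import Data.List.Relation.Unary.Unique.Propositional using (Unique)
open import Data.Nat using (ℕ; zero; suc; _≤_)
open import Data.Product using (_×_; _,_; proj₁)
open import Data.Sum using (_⊎_; swap)
open import Data.Vec using (tabulate)
open import Function using (_∘_; mk⇔)
open import Relation.Binary.Construct.Closure.ReflexiveTransitive using (Star)
open import Relation.Binary.PropositionalEquality
  using (_≡_; _≢_; refl; sym; cong₂)
open import Relation.Nullary using (¬_; Dec; does; ¬?; _×-dec_; _⊎-dec_)
open import Relation.Nullary.Decidable using (does-⇔; dec-false)

record Graph (n : ℕ) : Set where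
  field
    adj        : Fin n → Fin n → Bool
    adj-sym    : ∀ a b → adj a b ≡ adj b a
    adj-irrefl : ∀ a → adj a a ≡ false

  Adj : Fin n → Fin n → Set
  Adj a b = T (adj a b)

  N : Fin n → Subset n
  N a = tabulate (adj a)

open Graph public using (Adj; N)

Edgeless : ∀ {n} → Graph n → Set
Edgeless G = ∀ a b → ¬ Adj G a b

-- The condition on a b is a disjunction, so the pair uv, which satisfies both
-- disjuncts when u and v lie in X, is toggled only once.
Toggled : ∀ {n} (u v : Fin n) (X : Subset n) (a b : Fin n) → Set
Toggled u v X a b =
  a ≢ b × (((a ≡ u ⊎ a ≡ v) × b ∈ X) ⊎ ((b ≡ u ⊎ b ≡ v) × a ∈ X))

toggled? : ∀ {n} (u v : Fin n) (X : Subset n) (a b : Fin n) →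
           Dec (Toggled u v X a b)
toggled? u v X a b =
  ¬? (a ≟ b) ×-dec
  (((a ≟ u ⊎-dec a ≟ v) ×-dec b ∈? X) ⊎-dec ((b ≟ u ⊎-dec b ≟ v) ×-dec a ∈? X))

Toggled-sym : ∀ {n} {u v : Fin n} {X : Subset n} {a b : Fin n} →
              Toggled u v X a b → Toggled u v X b a
Toggled-sym (a≢b , p) = a≢b ∘ sym , swap p

toggle : ∀ {n} → Graph n → (u v : Fin n) → Subset n → Graph n
toggle G u v X = record
  { adj        = λ a b → adj a b xor does (toggled? u v X a b)
  ; adj-sym    = λ a b → cong₂ _xor_ (adj-sym a b)
                   (does-⇔ (mk⇔ Toggled-sym Toggled-sym)
                           (toggled? u v X a b) (toggled? u v X b a))
  ; adj-irrefl = λ a → cong₂ _xor_ (adj-irrefl a)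
                   (dec-false (toggled? u v X a a) (λ t → proj₁ t refl))
  }
  where open Graph G

record Reflection {n} (G : Graph n) : Set where
  field
    u v : Fin n
    uv  : Adj G u v
    X   : Subset n
    u∈X : u ∈ X
    v∈X : v ∈ X
    X⊆N : X ⊆ N G u ∪ N G v

reflect : ∀ {n} (G : Graph n) → Reflection G → Graph n
reflect G t = toggle G u v X
  where open Reflection t

data EdgelessAfter {n} : ℕ → Graph n → Set where
  done : ∀ {G} → Edgeless G → EdgelessAfter zero G
  step : ∀ {k G} (t : Reflection G) →
         EdgelessAfter k (reflect G t) → EdgelessAfter (suc k) G

RequiresExactly : ∀ {n} → Graph n → ℕ → Set
RequiresExactly G k = EdgelessAfter k G × (∀ j → EdgelessAfter j G → k ≤ j)

Connected : ∀ {n} → Graph n → Set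
Connected G = ∀ a b → Star (Adj G) a b

record Cycle {n} (G : Graph n) : Set where
  field
    start    : Fin n
    rest     : List (Fin n)
    distinct : Unique (start ∷ rest)
    length≥3 : 3 ≤ length (start ∷ rest)
    closed   : Linked (Adj G) (start ∷ rest ∷ʳ start)

Acyclic : ∀ {n} → Graph n → Set
Acyclic G = ¬ Cycle G

IsTree : ∀ {n} → Graph n → Set
IsTree G = Connected G × Acyclic G

{-# OPTIONS --safe #-}

-- Call a graph a forest if every edge is a bridge. The ends u, v of an edge of
-- a forest have no common neighbour, so a reflection only deletes uv and moves
-- some edges from u to v or from v to u: the graph remains a forest, and it
-- remains connected once uv is added back. Hence if a tree becomes edgeless
-- after j reflections, the j pairs uv connect all vertices, and n ≤ j + 1.
--
-- Taking X = {u} ∪ N(u) isolates u and replaces N(v) by the symmetric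
-- difference of N(u) and N(v), so n - 1 reflections always suffice. If fewer do
-- not, then by induction every such isolation leaves a tree T on the vertices
-- other than u. This forces G to be triangle-free, and then isolations
-- are contractions, which detect cycles. Suppose there is a triangle uvw, and
-- let w be the last common neighbour of u and v on a walk to v in T, followed
-- by p, …, q, v. If some neighbour of w is adjacent to exactly one of u and v, it
-- is the only one, and isolating w along wu and along wv cannot both give trees.
-- Otherwise p, …, q close up to a chordless cycle through w and one of u, v,
-- which contracts to a cycle.
module Submission where

open import Data.Bool using (true; false; T; not; _xor_)
open import Data.Bool.Properties using (T?; T-≡; xor-comm; xor-identityʳ)
open import Data.Fin using (Fin; zero; suc; _≟_; punchIn; punchOut)
open import Data.Fin.Properties
  using (any?; punchInᵢ≢i; punchOut-punchIn; punchOut-cong)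
open import Data.Fin.Subset using (⁅_⁆; _∪_) renaming (_∈_ to _∈ₛ_)
open import Data.Fin.Subset.Properties
  using (x∈⁅x⁆; x∈⁅y⁆⇒x≡y; p⊆p∪q; q⊆p∪q; x∈p∪q⁻)
open import Data.List using (List; []; _∷_; _∷ʳ_; length; filter; allFin)
open import Data.List.Membership.DecPropositional using () renaming (_∈?_ to member)
open import Data.List.Membership.Propositional using (_∈_; lose)
open import Data.List.Membership.Propositional.Properties using (∈-filter⁺; ∈-allFin)
open import Data.List.Properties using (filter-notAll; length-tabulate)
open import Data.List.Relation.Unary.All as All using (All; []; _∷_)
open import Data.List.Relation.Unary.All.Properties using (¬Any⇒All¬)
open import Data.List.Relation.Unary.AllPairs using ([]; _∷_)
open import Data.List.Relation.Unary.Any using (here; there)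
open import Data.List.Relation.Unary.Linked as Linked using (Linked; [-]; _∷_)
open import Data.List.Relation.Unary.Unique.Propositional using (Unique)
open import Data.Nat
  using (ℕ; zero; suc; _+_; _∸_; _≤_; _<_; z≤n; s≤s; s≤s⁻¹; NonZero)
open import Data.Nat.Properties
  using (≤-trans; ≤-reflexive; ≤-antisym; n≤1+n; m≤n⇒m≤1+n; +-suc; +-identityʳ)
open import Data.Product using (∃; _×_; _,_; proj₁; proj₂; swap)
open import Data.Sum using (_⊎_; inj₁; inj₂; [_,_]′)
open import Data.Vec.Properties using (lookup∘tabulate; lookup⇒[]=; []=⇒lookup)
open import Function using (_∘_; id; _⇔_; mk⇔; Equivalence)
open import Level using (0ℓ)
open import Relation.Binary using (Rel)
open import Relation.Binary.Construct.Closure.ReflexiveTransitive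
  using (Star; ε; _◅_; _◅◅_; return; reverse; map; kleisliStar)
open import Relation.Binary.PropositionalEquality
  using (_≡_; _≢_; refl; sym; trans; cong; subst; ≢-sym)
open import Relation.Nullary using (¬_; Dec; yes; no; contradiction; ¬?; _×-dec_)
open import Relation.Nullary.Decidable using (dec-true; dec-false)
open import Defs

open Equivalence using (to; from)

private
  variable
    n : ℕ

-- Exclusive or and adjacency

T-xor⁻ : ∀ x y → T (x xor y) → (T x × ¬ T y) ⊎ (¬ T x × T y)
T-xor⁻ true  false _ = inj₁ (_ , λ ())
T-xor⁻ false true  _ = inj₂ ((λ ()) , _)

T-xorˡ : ∀ {x y} → T x → ¬ T y → T (x xor y)
T-xorˡ {true} {true}  _ ¬y = ¬y _
T-xorˡ {true} {false} _ _  = _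

T-xorʳ : ∀ {x y} → ¬ T x → T y → T (x xor y)
T-xorʳ {true}  ¬x _ = contradiction _ ¬x
T-xorʳ {false} _  y = y

T-not⁻ : ∀ {x} → T (not x) → ¬ T x
T-not⁻ {false} _ ()

T-not⁺ : ∀ {x} → ¬ T x → T (not x)
T-not⁺ {true}  ¬x = ¬x _
T-not⁺ {false} _  = _

¬T⇒≡false : ∀ {x} → ¬ T x → x ≡ false
¬T⇒≡false {true}  ¬x = contradiction _ ¬x
¬T⇒≡false {false} _  = refl

module _ (G : Graph n) where

  adj? : ∀ a b → Dec (Adj G a b)
  adj? a b = T? (Graph.adj G a b)

  Adj-sym : ∀ {a b} → Adj G a b → Adj G b a
  Adj-sym {a} {b} = subst T (Graph.adj-sym G a b)

  Adj-irrefl : ∀ {a} → ¬ Adj G a a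
  Adj-irrefl {a} = subst T (Graph.adj-irrefl G a)

  Adj⇒≢ : ∀ {a b} → Adj G a b → a ≢ b
  Adj⇒≢ e refl = Adj-irrefl e

  ∈N⁺ : ∀ {a b} → Adj G a b → b ∈ₛ N G a
  ∈N⁺ {a} {b} e = lookup⇒[]= b (N G a) (trans (lookup∘tabulate _ b) (to T-≡ e))

  ∈N⁻ : ∀ {a b} → b ∈ₛ N G a → Adj G a b
  ∈N⁻ {a} {b} i = from T-≡ (trans (sym (lookup∘tabulate _ b)) ([]=⇒lookup i))

-- Reflections and the isolation of a vertex

Off : (u v x : Fin n) → Set
Off u v x = x ≢ u × x ≢ v

module _ (G : Graph n) (t : Reflection G) where
  open Reflection t

  adj-untoggled : ∀ {a b} → ¬ Toggled u v X a b →
                  Graph.adj (reflect G t) a b ≡ Graph.adj G a b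
  adj-untoggled {a} {b} ¬t =
    trans (cong (Graph.adj G a b xor_) (dec-false (toggled? u v X a b) ¬t))
          (xor-identityʳ _)

  adj-toggled : ∀ {a b} → Toggled u v X a b →
                Graph.adj (reflect G t) a b ≡ not (Graph.adj G a b)
  adj-toggled {a} {b} t =
    trans (cong (Graph.adj G a b xor_) (dec-true (toggled? u v X a b) t))
          (xor-comm _ true)

  toggled⇒removed : ∀ {a b} → Toggled u v X a b → Adj G a b → ¬ Adj (reflect G t) a b
  toggled⇒removed t e e′ = T-not⁻ (subst T (adj-toggled t) e′) e

  removed : ¬ Adj (reflect G t) u v
  removed = toggled⇒removed (Adj⇒≢ G uv , inj₁ (inj₁ refl , v∈X)) uv

-- Modulo the vertex u, which becomes isolated, H is G with the edge uv
-- contracted and the resulting double edges deleted.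
record Isolates (G : Graph n) (u v : Fin n) (H : Graph n) : Set where
  field
    away     : ∀ {a b} → Off u v a → Off u v b → Graph.adj H a b ≡ Graph.adj G a b
    isolated : ∀ {b} → ¬ Adj H u b
    merged   : ∀ {b} → Off u v b →
               Graph.adj H v b ≡ Graph.adj G v b xor Graph.adj G u b

module _ (G : Graph n) {u v : Fin n} (uv : Adj G u v) where

  isolating : Reflection G
  isolating = record
    { u = u ; v = v ; uv = uv
    ; X = ⁅ u ⁆ ∪ N G u
    ; u∈X = p⊆p∪q _ (x∈⁅x⁆ u)
    ; v∈X = q⊆p∪q _ _ (∈N⁺ G uv)
    ; X⊆N = λ x∈X → [ (λ x∈u → q⊆p∪q _ _
                          (subst (_∈ₛ N G v) (sym (x∈⁅y⁆⇒x≡y u x∈u)) (∈N⁺ G (Adj-sym G uv))))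
                    , p⊆p∪q _ ]′ (x∈p∪q⁻ _ _ x∈X)
    }

  isolate : Graph n
  isolate = reflect G isolating

  private
    ∈X⁻ : ∀ {b} → b ≢ u → b ∈ₛ ⁅ u ⁆ ∪ N G u → Adj G u b
    ∈X⁻ b≢u b∈X =
      [ (λ b∈u → contradiction (x∈⁅y⁆⇒x≡y u b∈u) b≢u) , ∈N⁻ G ]′ (x∈p∪q⁻ _ _ b∈X)

    ∈X⁺ : ∀ {b} → Adj G u b → b ∈ₛ ⁅ u ⁆ ∪ N G u
    ∈X⁺ = q⊆p∪q _ _ ∘ ∈N⁺ G

  -- Apart from `u`, the set `X` is N(u). So at `u` all edges and no nonedges are toggled, and at
  -- `v` the pairs `vb` with `b` ≠ `u` are toggled exactly when `b` is in N(u).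
  isolate-isolates : Isolates G u v isolate
  isolate-isolates = record
    { away = λ { (a≢u , a≢v) (b≢u , b≢v) → adj-untoggled G isolating λ
        { (_ , inj₁ (a∈uv , _)) → [ a≢u , a≢v ]′ a∈uv
        ; (_ , inj₂ (b∈uv , _)) → [ b≢u , b≢v ]′ b∈uv } }
    ; isolated = isolated
    ; merged = merged
    }
    where
    isolated : ∀ {b} → ¬ Adj isolate u b
    isolated {b} e with adj? G u b
    ... | yes ub = toggled⇒removed G isolating (Adj⇒≢ G ub , inj₁ (inj₁ refl , ∈X⁺ ub)) ub e
    ... | no ¬ub = ¬ub (subst T (adj-untoggled G isolating λ
      { (u≢b , inj₁ (_ , b∈X))         → ¬ub (∈X⁻ (≢-sym u≢b) b∈X)
      ; (u≢b , inj₂ (inj₁ b≡u , _))    → u≢b (sym b≡u)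
      ; (_   , inj₂ (inj₂ refl , _))   → ¬ub uv }) e)

    merged : ∀ {b} → Off u v b →
             Graph.adj isolate v b ≡ Graph.adj G v b xor Graph.adj G u b
    merged {b} (b≢u , b≢v) with adj? G u b
    ... | yes ub = trans (adj-toggled G isolating (≢-sym b≢v , inj₁ (inj₂ refl , ∈X⁺ ub)))
                         (trans (xor-comm true (Graph.adj G v b))
                                (cong (Graph.adj G v b xor_) (sym (to T-≡ ub))))
    ... | no ¬ub = trans (adj-untoggled G isolating λ
                            { (_ , inj₁ (_ , b∈X))     → ¬ub (∈X⁻ b≢u b∈X)
                            ; (_ , inj₂ (b∈uv , _)) → [ b≢u , b≢v ]′ b∈uv })
                         (sym (trans (cong (Graph.adj G v b xor_) (¬T⇒≡false ¬ub))
                                     (xor-identityʳ _)))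

module Isolation {n} {G H : Graph n} {u v : Fin n} (uv : Adj G u v) (iso : Isolates G u v H) where
  open Isolates iso public

  away⁺ : ∀ {a b} → Off u v a → Off u v b → Adj G a b → Adj H a b
  away⁺ a b = subst T (sym (away a b))

  away⁻ : ∀ {a b} → Off u v a → Off u v b → Adj H a b → Adj G a b
  away⁻ a b = subst T (away a b)

  keep : ∀ {b} → b ≢ u → Adj G v b → ¬ Adj G u b → Adj H v b
  keep b≢u vb ¬ub = subst T (sym (merged (b≢u , ≢-sym (Adj⇒≢ G vb)))) (T-xorˡ vb ¬ub)

  gain : ∀ {b} → b ≢ v → ¬ Adj G v b → Adj G u b → Adj H v b
  gain b≢v ¬vb ub = subst T (sym (merged (≢-sym (Adj⇒≢ G ub) , b≢v))) (T-xorʳ ¬vb ub)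

  ≢u : ∀ {a b} → Adj H a b → a ≢ u
  ≢u e refl = isolated e

  ≢u′ : ∀ {a b} → Adj H a b → b ≢ u
  ≢u′ e = ≢u (Adj-sym H e)

  split : ∀ {b} → Adj H v b → (Adj G v b × ¬ Adj G u b) ⊎ (¬ Adj G v b × Adj G u b)
  split e = T-xor⁻ _ _ (subst T (merged (≢u′ e , ≢-sym (Adj⇒≢ H e))) e)

  -- An edge that `v` takes over from `u` is replaced by a detour through `uv`.
  H⇒walk : ∀ {a b} → Adj H a b → Star (Adj G) a b
  H⇒walk {a} {b} e with a ≟ v | b ≟ v
  ... | yes refl | _ = from-v e
    where
    from-v : ∀ {b} → Adj H v b → Star (Adj G) v b
    from-v e = [ return ∘ proj₁ , (λ p → Adj-sym G uv ◅ return (proj₂ p)) ]′ (split e)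
  ... | no a≢v | no b≢v = return (away⁻ (≢u e , a≢v) (≢u′ e , b≢v) e)
  ... | no a≢v | yes refl =
    [ (λ p → return (Adj-sym G (proj₁ p))) , (λ p → Adj-sym G (proj₂ p) ◅ return uv) ]′
      (split (Adj-sym H e))

-- Forests

Avoid : Graph n → (a b x y : Fin n) → Set
Avoid G a b x y = Adj G x y × ¬ (x ≡ a × y ≡ b) × ¬ (x ≡ b × y ≡ a)

-- Walks may repeat vertices, so they can be carried to another graph edge by edge, whereas the
-- vertices of a cycle would have to be kept distinct.
Forest : Graph n → Set
Forest G = ∀ {a b} → Adj G a b → ¬ Star (Avoid G a b) a b

Without : Graph n → (s x y : Fin n) → Set
Without G s x y = Adj G x y × x ≢ s × y ≢ s

module _ (G : Graph n) where

  avoid-comm : ∀ {a b x y} → Avoid G a b x y → Avoid G b a x y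
  avoid-comm (e , p , q) = e , q , p

  avoid-sym : ∀ {a b x y} → Avoid G a b x y → Avoid G a b y x
  avoid-sym (e , p , q) = Adj-sym G e , q ∘ swap , p ∘ swap

  private
    without⇒avoid : ∀ {s p x y} → Without G s x y → Avoid G p s x y
    without⇒avoid (e , x≢s , y≢s) = e , y≢s ∘ proj₂ , x≢s ∘ proj₁

  -- Otherwise the walk followed by the edge `qs` would join the ends of `sp` without using that
  -- edge.
  no-return : Forest G → ∀ {s p q} → Adj G s p → Adj G s q →
              Star (Without G s) p q → p ≡ q
  no-return F {s} {p} {q} sp sq w with p ≟ q
  ... | yes p≡q = p≡q
  ... | no  p≢q = contradiction
    (map without⇒avoid w ◅◅
      return (Adj-sym G sq , p≢q ∘ sym ∘ proj₁ , Adj⇒≢ G sq ∘ sym ∘ proj₁))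
    (F (Adj-sym G sp))

-- Reflections of forests

module ReflectForest {n} (G : Graph n) (t : Reflection G) (F : Forest G) where
  open Reflection t

  private
    G′ = reflect G t

  data Ends : Fin n → Fin n → Set where
    u-v : Ends u v
    v-u : Ends v u

  swap-ends : ∀ {p q} → Ends p q → Ends q p
  swap-ends u-v = v-u
  swap-ends v-u = u-v

  ends-unique : ∀ {p p′ q} → Ends p q → Ends p′ q → p ≡ p′
  ends-unique u-v u-v = refl
  ends-unique u-v v-u = contradiction uv (Adj-irrefl G)
  ends-unique v-u u-v = contradiction uv (Adj-irrefl G)
  ends-unique v-u v-u = refl

  ends-inside : ∀ {p q} → Ends p q → ¬ Off u v p
  ends-inside u-v (u≢u , _) = u≢u refl
  ends-inside v-u (_ , v≢v) = v≢v refl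

  ends-adj : ∀ {p q} → Ends p q → Adj G p q
  ends-adj u-v = uv
  ends-adj v-u = Adj-sym G uv

  ends-removed : ∀ {p q} → Ends p q → ¬ Adj G′ p q
  ends-removed u-v = removed G t
  ends-removed v-u = removed G t ∘ Adj-sym G′

  ends-toggle : ∀ {p q b} → Ends p q → b ∈ₛ X → p ≢ b → Toggled u v X p b
  ends-toggle u-v b∈X p≢b = p≢b , inj₁ (inj₁ refl , b∈X)
  ends-toggle v-u b∈X p≢b = p≢b , inj₁ (inj₂ refl , b∈X)

  no-triangle : ∀ {w} → Adj G u w → ¬ Adj G v w
  no-triangle uw vw = Adj⇒≢ G uv (no-return G F (Adj-sym G uw) (Adj-sym G vw)
    (return (uv , Adj⇒≢ G uw , Adj⇒≢ G vw)))

  -- The edge pb of the reflected graph replaces the edge qb of G.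
  record Moved (p q b : Fin n) : Set where
    constructor moved
    field
      ends : Ends p q
      off  : Off u v b
      old  : Adj G q b
      gone : ¬ Adj G′ q b

  private
    move : ∀ {p q b} → Ends p q → b ∈ₛ X → p ≢ b → ¬ Adj G p b → Moved p q b
    move {p} {q} {b} pq b∈X p≢b ¬pb = moved pq (off pq p≢b q≢b) qb
      (toggled⇒removed G t (ends-toggle (swap-ends pq) b∈X q≢b) qb)
      where
      q≢b : q ≢ b
      q≢b refl = ¬pb (ends-adj pq)

      adjacent : ∀ {p q} → Ends p q → ¬ Adj G p b → Adj G u b ⊎ Adj G v b → Adj G q b
      adjacent u-v ¬pb = [ (λ e → contradiction e ¬pb) , id ]′
      adjacent v-u ¬pb = [ id , (λ e → contradiction e ¬pb) ]′

      -- `X` lies in N(u) ∪ N(v), so a member not adjacent to `p` is adjacent to `q`.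
      qb : Adj G q b
      qb = adjacent pq ¬pb ([ inj₁ ∘ ∈N⁻ G , inj₂ ∘ ∈N⁻ G ]′ (x∈p∪q⁻ _ _ (X⊆N b∈X)))

      off : ∀ {p q} → Ends p q → p ≢ b → q ≢ b → Off u v b
      off u-v p≢b q≢b = ≢-sym p≢b , ≢-sym q≢b
      off v-u p≢b q≢b = ≢-sym q≢b , ≢-sym p≢b

  new-edge : ∀ {a b} → Adj G′ a b → ¬ Adj G a b →
             (∃ λ q → Moved a q b) ⊎ (∃ λ q → Moved b q a)
  new-edge {a} {b} e ¬ab with toggled? u v X a b
  ... | no ¬t = contradiction (subst T (adj-untoggled G t ¬t) e) ¬ab
  ... | yes (a≢b , inj₁ (inj₁ refl , b∈X)) = inj₁ (_ , move u-v b∈X a≢b ¬ab)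
  ... | yes (a≢b , inj₁ (inj₂ refl , b∈X)) = inj₁ (_ , move v-u b∈X a≢b ¬ab)
  ... | yes (a≢b , inj₂ (inj₁ refl , a∈X)) =
    inj₂ (_ , move u-v a∈X (≢-sym a≢b) (¬ab ∘ Adj-sym G))
  ... | yes (a≢b , inj₂ (inj₂ refl , a∈X)) =
    inj₂ (_ , move v-u a∈X (≢-sym a≢b) (¬ab ∘ Adj-sym G))

  private
    differ : ∀ {a b x y} → Adj G′ a b → Adj G x y → ¬ Adj G′ x y → Avoid G a b x y
    differ ab xy ¬xy = xy , (λ { (refl , refl) → ¬xy ab })
                          , (λ { (refl , refl) → ¬xy (Adj-sym G′ ab) })

    -- Both edges of the detour x, q, y are absent from the reflected graph, so neither is `ab`.
    detour : ∀ {a b x y q} → Adj G′ a b → Moved x q y → Star (Avoid G a b) x y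
    detour ab (moved xq _ qy ¬qy) =
      differ ab (ends-adj xq) (ends-removed xq) ◅ return (differ ab qy ¬qy)

    lift-old : ∀ {a b x y} → Adj G′ a b → Avoid G′ a b x y → Star (Avoid G a b) x y
    lift-old {x = x} {y} ab (xy , ≢₁ , ≢₂) with adj? G x y
    ... | yes xy₀ = return (xy₀ , ≢₁ , ≢₂)
    ... | no ¬xy with new-edge xy ¬xy
    ...   | inj₁ (_ , m) = detour ab m
    ...   | inj₂ (_ , m) = reverse (avoid-sym G) (detour ab m)

    -- Neither edge of the detour x, r, y is `qb`: `xr` is the edge `uv`, while `b` is off both
    -- ends; and `ry` = `qb` would force `x` = `a`, making `xy` the avoided edge `ab`.
    detour-new : ∀ {a b q x y r} → Moved a q b → ¬ (x ≡ a × y ≡ b) →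
                 Moved x r y → Star (Avoid G q b) x y
    detour-new (moved aq (b≢u , b≢v) _ _) ≢₁ (moved xr y-off ry _) =
      (ends-adj xr , (λ { (refl , refl) → ends-inside (swap-ends xr) (b≢u , b≢v) })
                   , (λ { (refl , refl) → ends-inside xr (b≢u , b≢v) }))
      ◅ return (ry , (λ { (refl , refl) → ≢₁ (ends-unique xr aq , refl) })
                   , (λ { (refl , refl) → ends-inside (swap-ends xr) (b≢u , b≢v) }))

    lift-new : ∀ {a b q x y} → Moved a q b → Avoid G′ a b x y → Star (Avoid G q b) x y
    lift-new {x = x} {y} m@(moved aq b-off _ ¬qb) (xy , ≢₁ , ≢₂) with adj? G x y
    ... | yes xy₀ = return (xy₀ , (λ { (refl , refl) → ¬qb xy })
                                , (λ { (refl , refl) → ¬qb (Adj-sym G′ xy) }))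
    ... | no ¬xy with new-edge xy ¬xy
    ...   | inj₁ (_ , m′) = detour-new m ≢₁ m′
    ...   | inj₂ (_ , m′) = reverse (avoid-sym G) (detour-new m (≢₂ ∘ swap) m′)

    -- Prefixed by the edge `qa`, the lifted walk would join `q` to `b` without using the bridge
    -- `qb` of `G`.
    moved-bridge : ∀ {a b q} → Moved a q b → ¬ Star (Avoid G′ a b) a b
    moved-bridge m@(moved aq b-off qb _) w = F qb
      ((ends-adj (swap-ends aq) , (λ { (_ , refl) → ends-inside aq b-off })
                                , (λ { (refl , _) → ends-inside (swap-ends aq) b-off }))
       ◅ kleisliStar id (lift-new m) w)

  reflect-forest : Forest G′
  reflect-forest {a} {b} ab w with adj? G a b
  ... | yes ab₀ = F ab₀ (kleisliStar id (lift-old ab) w)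
  ... | no ¬ab with new-edge ab ¬ab
  ...   | inj₁ (_ , m) = moved-bridge m w
  ...   | inj₂ (_ , m) = moved-bridge m
    (reverse (avoid-sym G′) (map (avoid-comm G′) w))

-- The lower bound for trees

Respects : ∀ {m} → (Fin n → Fin m) → List (Fin n × Fin n) → Set
Respects c = All (λ (a , b) → c a ≡ c b)

-- Adding the pairs in ps as edges makes G connected.
ConnectedBy : List (Fin n × Fin n) → Graph n → Set
ConnectedBy {n} ps G = ∀ {m} (c : Fin n → Fin m) → (∀ {a b} → Adj G a b → c a ≡ c b) →
                       Respects c ps → ∀ a b → c a ≡ c b

connected⇒connectedBy : {G : Graph n} → Connected G → ConnectedBy [] G
connected⇒connectedBy {G = G} conn c resp [] a b = follow (conn a b)
  where
  follow : ∀ {a b} → Star (Adj G) a b → c a ≡ c b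
  follow ε       = refl
  follow (e ◅ w) = trans (resp e) (follow w)

merge : ∀ {m} {i j : Fin (suc m)} → i ≢ j → Fin (suc m) → Fin m
merge {i = i} i≢j k with i ≟ k
... | yes _   = punchOut i≢j
... | no  i≢k = punchOut i≢k

merge-merges : ∀ {m} {i j : Fin (suc m)} (i≢j : i ≢ j) → merge i≢j i ≡ merge i≢j j
merge-merges {i = i} {j} i≢j with i ≟ i | i ≟ j
... | no i≢i | _       = contradiction refl i≢i
... | yes _  | yes i≡j = contradiction i≡j i≢j
... | yes _  | no _    = punchOut-cong i refl

merge-punchIn : ∀ {m} {i j : Fin (suc m)} (i≢j : i ≢ j) k → merge i≢j (punchIn i k) ≡ k
merge-punchIn {i = i} i≢j k with i ≟ punchIn i k
... | yes i≡ = contradiction (sym i≡) (punchInᵢ≢i i k)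
... | no  _  = trans (punchOut-cong i refl) (punchOut-punchIn i)

-- Starting from n singleton classes, each pair merges at most two of them. Surjectivity makes every
-- class inhabited, so `c` is not constant once there are two classes.
quotient : (ps : List (Fin n × Fin n)) →
           ∃ λ m → ∃ λ (c : Fin n → Fin m) →
             (∀ k → ∃ λ a → c a ≡ k) × Respects c ps × n ≤ m + length ps
quotient {n} [] = n , (λ a → a) , (λ k → k , refl) , [] , ≤-reflexive (sym (+-identityʳ n))
quotient ((a , b) ∷ ps) with quotient ps
... | m , c , surj , resp , n≤ with c a ≟ c b
...   | yes eq = m , c , surj , eq ∷ resp ,
    ≤-trans n≤ (≤-trans (n≤1+n _) (≤-reflexive (sym (+-suc m _))))
quotient ((a , b) ∷ ps) | zero , c , _ | no _ = contradiction (c a) λ ()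
quotient ((a , b) ∷ ps) | suc m , c , surj , resp , n≤ | no neq =
  m , merge neq ∘ c
  , (λ k → let x , cx≡ = surj (punchIn (c a) k)
           in x , trans (cong (merge neq) cx≡) (merge-punchIn neq k))
  , merge-merges neq ∷ All.map (cong (merge neq)) resp
  , ≤-trans n≤ (≤-reflexive (sym (+-suc m _)))

-- A deleted edge `pb` other than `uv` is replaced by `qb`, which was not an edge since there are no
-- triangles; the added pair `uv` gives `p` and `q` the same colour.
reflect-connectedBy : {G : Graph n} {ps : List (Fin n × Fin n)} (t : Reflection G) →
                      Forest G → ConnectedBy ps G →
                      ConnectedBy ((Reflection.u t , Reflection.v t) ∷ ps) (reflect G t)
reflect-connectedBy {G = G} t F conn c resp (uv≡ ∷ resps) = conn c resp′ resps
  where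
  open Reflection t
  open ReflectForest G t F

  ends≡ : ∀ {p q} → Ends p q → c p ≡ c q
  ends≡ u-v = uv≡
  ends≡ v-u = sym uv≡

  other : ∀ {p q b} → Ends p q → Adj G p b → b ∈ₛ X → b ≢ q → c p ≡ c b
  other {p} {q} {b} pq pb b∈X b≢q = trans (ends≡ pq) (resp
    (subst T (sym (adj-toggled G t (ends-toggle (swap-ends pq) b∈X (≢-sym b≢q))))
             (T-not⁺ (¬qb pq pb))))
    where
    ¬qb : ∀ {p q} → Ends p q → Adj G p b → ¬ Adj G q b
    ¬qb u-v = no-triangle
    ¬qb v-u vb ub = no-triangle ub vb

  across : ∀ {p q b} → Ends p q → Adj G p b → b ∈ₛ X → c p ≡ c b
  across {q = q} {b} pq pb b∈X with b ≟ q
  ... | yes refl = ends≡ pq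
  ... | no  b≢q  = other pq pb b∈X b≢q

  resp′ : ∀ {a b} → Adj G a b → c a ≡ c b
  resp′ {a} {b} e with toggled? u v X a b
  ... | no ¬t = resp (subst T (sym (adj-untoggled G t ¬t)) e)
  ... | yes (_ , inj₁ (inj₁ refl , b∈X)) = across u-v e b∈X
  ... | yes (_ , inj₁ (inj₂ refl , b∈X)) = across v-u e b∈X
  ... | yes (_ , inj₂ (inj₁ refl , a∈X)) = sym (across u-v (Adj-sym G e) a∈X)
  ... | yes (_ , inj₂ (inj₂ refl , a∈X)) = sym (across v-u (Adj-sym G e) a∈X)

-- The list `ps` collects the pairs `uv` used so far. Once the graph is edgeless, they alone connect
-- all vertices, so their quotient has at most one class.
forest-lower-bound : ∀ {G : Graph n} {j ps} → Forest G → ConnectedBy ps G →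
                     EdgelessAfter j G → n ≤ suc (j + length ps)
forest-lower-bound {ps = ps} F conn (done none) with quotient ps
... | zero        , _ , _    , _    , n≤ = m≤n⇒m≤1+n n≤
... | suc zero    , _ , _    , _    , n≤ = n≤
... | suc (suc m) , c , surj , resp , n≤ with surj zero | surj (suc zero)
...   | a , ca≡ | b , cb≡ =
  contradiction (trans (sym ca≡) (trans (c-constant a b) cb≡)) λ ()
  where
  c-constant : ∀ a b → c a ≡ c b
  c-constant = conn c (λ {a} {b} e → contradiction e (none a b)) resp
forest-lower-bound {G = G} {suc j} {ps} F conn (step t r) = ≤-trans
  (forest-lower-bound (ReflectForest.reflect-forest G t F) (reflect-connectedBy t F conn) r)
  (s≤s (≤-reflexive (+-suc j (length ps))))

-- Forests and cycles

module _ {R : Rel (Fin n) 0ℓ} where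

  -- `b` leads the list of distinct vertices so that an edge `ba` turns the path into a cycle
  -- starting at `b`.
  SimplePath : (a b : Fin n) → Set
  SimplePath a b = ∃ λ xs → Linked R (a ∷ xs ∷ʳ b) × Unique (b ∷ a ∷ xs)

  private
    suffix : ∀ {a b xs} → a ∈ xs → Linked R (xs ∷ʳ b) → Unique (b ∷ xs) → SimplePath a b
    suffix {xs = a ∷ xs}     (here refl) l u = xs , l , u
    suffix {xs = x ∷ y ∷ xs} (there i) (_ ∷ l) ((_ ∷ b∉) ∷ _ ∷ u) = suffix i l (b∉ ∷ u)

  loop-erase : ∀ {a b} → Star R a b → a ≡ b ⊎ SimplePath a b
  loop-erase ε = inj₁ refl
  loop-erase {a} {b} (_◅_ {j = x} r w) with a ≟ b
  ... | yes a≡b = inj₁ a≡b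
  ... | no  a≢b with loop-erase w
  ...   | inj₁ refl = inj₂ ([] , r ∷ [-] , (≢-sym a≢b ∷ []) ∷ [] ∷ [])
  ...   | inj₂ (xs , l , b∉@(b≢x ∷ _) ∷ u) with member _≟_ a (x ∷ xs)
  ...     | yes a∈ = inj₂ (suffix a∈ l (b∉ ∷ u))
  ...     | no  a∉ = inj₂ (x ∷ xs , r ∷ l , (≢-sym a≢b ∷ b∉) ∷ ¬Any⇒All¬ (x ∷ xs) a∉ ∷ u)

acyclic⇒forest : {G : Graph n} → Acyclic G → Forest G
acyclic⇒forest {G = G} acyclic {a} {b} ab w with loop-erase w
... | inj₁ refl = Adj-irrefl G ab
-- A path without inner vertices would be the avoided edge `ab` itself.
... | inj₂ ([] , (_ , ≢ab , _) ∷ _ , _) = ≢ab (refl , refl)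
... | inj₂ (x ∷ xs , l , u) = acyclic record
  { start    = b
  ; rest     = a ∷ x ∷ xs
  ; distinct = u
  ; length≥3 = s≤s (s≤s (s≤s z≤n))
  ; closed   = Adj-sym G ab ∷ Linked.map proj₁ l
  }

forest⇒acyclic : {G : Graph n} → Forest G → Acyclic G
forest⇒acyclic F record { rest = [] ; length≥3 = s≤s () }
forest⇒acyclic F record { rest = _ ∷ [] ; length≥3 = s≤s (s≤s ()) }
forest⇒acyclic {G = G} F record
  { start = s ; rest = x ∷ y ∷ zs
  ; distinct = (_ ∷ s∉) ∷ x∉ ∷ _ ; closed = sx ∷ xy ∷ l } =
  F (Adj-sym G sx)
    -- The cycle without its edge `xs` is a walk from `x` to `s`. Since `leave` needs a first vertex
    -- different from both, the edge `xy` is read from the side of `y`.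
    (avoid-sym G (leave (Adj-sym G xy) (≢-sym (All.head x∉)) (≢-sym (All.head s∉)))
      ◅ walk s∉ x∉ l)
  where
  leave : ∀ {p q} → Adj G p q → p ≢ x → p ≢ s → Avoid G x s p q
  leave e p≢x p≢s = e , p≢x ∘ proj₁ , p≢s ∘ proj₁

  walk : ∀ {p zs} → All (s ≢_) (p ∷ zs) → All (x ≢_) (p ∷ zs) →
         Linked (Adj G) (p ∷ zs ∷ʳ s) → Star (Avoid G x s) p s
  walk {zs = []}    (s≢p ∷ _)  (x≢p ∷ _)  (e ∷ _) = return (leave e (≢-sym x≢p) (≢-sym s≢p))
  walk {zs = _ ∷ _} (s≢p ∷ s∉) (x≢p ∷ x∉) (e ∷ l) = leave e (≢-sym x≢p) (≢-sym s≢p) ◅ walk s∉ x∉ l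

-- Graphs whose isolations are trees

module _ {G H₁ H₂ : Graph n} {u v w p : Fin n}
         (wu : Adj G w u) (wv : Adj G w v) (pw : Adj G p w) (vp : Adj G v p)
         (¬up : ¬ Adj G u p) (p≢u : p ≢ u)
         (twins : ∀ {x} → x ≢ p → Off u v x → Adj G w x →
                  (Adj G u x → Adj G v x) × (Adj G v x → Adj G u x))
         (iso₁ : Isolates G w u H₁) (iso₂ : Isolates G w v H₂) where

  private
    module I₁ = Isolation wu iso₁
    module I₂ = Isolation wv iso₂

    u≢v : u ≢ v
    u≢v refl = ¬up vp

    Inner : Fin n → Fin n → Set
    Inner x y = Adj H₁ x y × Off u v x × Off u v y

    up₁ : Adj H₁ u p
    up₁ = I₁.gain p≢u ¬up (Adj-sym G pw)

    vp₁ : Adj H₁ v p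
    vp₁ = I₁.away⁺ (≢-sym (Adj⇒≢ G wv) , ≢-sym u≢v) (Adj⇒≢ G pw , p≢u) vp

    -- Neighbours of w other than p swap sides between H₁ and H₂.
    attached : ∀ {x} → Off u v x → Adj H₂ u x ⊎ Adj H₂ v x →
               x ≢ p × (Adj H₁ u x ⊎ Adj H₁ v x)
    attached {x} x-off@(x≢u , x≢v) (inj₁ ux₂) = x≢p , side (adj? G w x)
      where
      x≢w : x ≢ w
      x≢w = I₂.≢u′ ux₂
      ux : Adj G u x
      ux = I₂.away⁻ (≢-sym (Adj⇒≢ G wu) , u≢v) (x≢w , x≢v) ux₂
      x≢p : x ≢ p
      x≢p refl = ¬up ux
      side : Dec (Adj G w x) → Adj H₁ u x ⊎ Adj H₁ v x
      side (yes wx) = inj₂ (I₁.away⁺ (≢-sym (Adj⇒≢ G wv) , ≢-sym u≢v) (x≢w , x≢u)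
                              (proj₁ (twins x≢p x-off wx) ux))
      side (no ¬wx) = inj₁ (I₁.keep x≢w ux ¬wx)
    attached {x} x-off@(x≢u , x≢v) (inj₂ vx₂) with I₂.split vx₂
    ... | inj₁ (vx , ¬wx) = (λ { refl → ¬wx (Adj-sym G pw) })
        , inj₂ (I₁.away⁺ (≢-sym (Adj⇒≢ G wv) , ≢-sym u≢v) (I₂.≢u′ vx₂ , x≢u) vx)
    ... | inj₂ (¬vx , wx) = x≢p
        , inj₁ (I₁.gain x≢u (¬vx ∘ proj₁ (twins x≢p x-off wx)) wx)
      where
      x≢p : x ≢ p
      x≢p refl = ¬vx vp

    stuck : Forest H₁ → ∀ {x} → Off u v x → Star Inner p x →
            ¬ (Adj H₂ u x ⊎ Adj H₂ v x)
    stuck F x-off walk e with attached x-off e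
    ... | x≢p , inj₁ ux = x≢p (sym (no-return H₁ F up₁ ux
          (map (λ (e , (x≢u , _) , (y≢u , _)) → e , x≢u , y≢u) walk)))
    ... | x≢p , inj₂ vx = x≢p (sym (no-return H₁ F vp₁ vx
          (map (λ (e , (_ , x≢v) , (_ , y≢v)) → e , x≢v , y≢v) walk)))

    trapped : Forest H₁ → ∀ {x} → Off u v x → Star Inner p x → ¬ Star (Adj H₂) x u
    trapped F (x≢u , _) walk ε = x≢u refl
    trapped F {x} x-off walk (_◅_ {j = y} xy w₂) with y ≟ u | y ≟ v
    ... | yes refl | _        = stuck F x-off walk (inj₁ (Adj-sym H₂ xy))
    ... | no _     | yes refl = stuck F x-off walk (inj₂ (Adj-sym H₂ xy))
    ... | no y≢u   | no y≢v   =
      trapped F (y≢u , y≢v) (walk ◅◅ return (xy₁ , x-off , (y≢u , y≢v))) w₂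
      where
      xy₁ : Adj H₁ x y
      xy₁ = I₁.away⁺ (I₂.≢u xy , proj₁ x-off) (I₂.≢u′ xy , y≢u)
              (I₂.away⁻ (I₂.≢u xy , proj₂ x-off) (I₂.≢u′ xy , y≢v) xy)

  -- In `H₁` the vertex `p` is adjacent to both `u` and `v`, so no walk from `p` off `u` and `v`
  -- reaches another neighbour of either. `H₂` agrees with `H₁` off `u` and `v`, and by `attached`
  -- it offers no new vertex from which to enter `u` or `v`, nor `p` itself.
  isolations-not-both-trees : Forest H₁ → ¬ Star (Adj H₂) p u
  isolations-not-both-trees F = trapped F (p≢u , ≢-sym (Adj⇒≢ G vp)) ε

-- A chordless cycle w p … q v of length at least four survives the contraction of wv.
contracted-cycle : ∀ {G H : Graph n} {w v p q : Fin n} → (wv : Adj G w v) → Isolates G w v H →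
  Forest H → Adj G w p → ¬ Adj G v p → p ≢ v → Adj G v q → ¬ Adj G w q → q ≢ w →
  ¬ Star (λ x y → Adj G x y × Off w v x × Off w v y) p q
contracted-cycle {G = G} {H} wv iso F wp ¬vp p≢v vq ¬wq q≢w walk =
  ¬vp (subst (Adj G _) (sym p≡q) vq)
  where
  open Isolation wv iso
  p≡q = no-return H F (gain p≢v ¬vp wp) (keep q≢w vq ¬wq)
    (map (λ (e , x@(_ , x≢v) , y@(_ , y≢v)) → away⁺ x y e , x≢v , y≢v) walk)

-- Vertices isolated earlier remain in the graph, so connectedness is asked only of vertices that
-- have a neighbour in `G`.
IsolationsAreTrees : Graph n → Set
IsolationsAreTrees G = ∀ {u v} → Adj G u v → ∃ λ H → Isolates G u v H × Forest H ×
  (∀ {a b c d} → a ≢ u → b ≢ u → Adj G a c → Adj G b d → Star (Adj H) a b)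

module NoTriangle {n} (G : Graph n) (trees : IsolationsAreTrees G) where

  private
    Common : (u v x : Fin n) → Set
    Common u v x = Adj G u x × Adj G v x

    common? : ∀ u v x → Dec (Common u v x)
    common? u v x = adj? G u x ×-dec adj? G v x

    lopsided : ∀ {u v w p} → Adj G u v → Adj G w u → Adj G w v → Adj G p w →
      Adj G v p → ¬ Adj G u p → p ≢ u →
      ¬ (∀ {x} → x ≢ p → Off u v x → Adj G w x →
         (Adj G u x → Adj G v x) × (Adj G v x → Adj G u x))
    lopsided uv wu wv pw vp ¬up p≢u twins with trees wu | trees wv
    ... | _ , iso₁ , F₁ , _ | _ , iso₂ , _ , conn₂ =
      isolations-not-both-trees wu wv pw vp ¬up p≢u twins iso₁ iso₂ F₁
        (conn₂ (Adj⇒≢ G pw) (≢-sym (Adj⇒≢ G wu)) pw uv)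

    module Contracted {u v : Fin n} (uv : Adj G u v) {T : Graph n}
                      (iso : Isolates G u v T) (F : Forest T) where
      open Isolation uv iso

      -- Off `u` and `v`, the neighbours of `v` in `T` are the vertices adjacent in `G` to exactly
      -- one of the two. Two such neighbours of `w` would be joined through `w` in the forest `T`,
      -- so the other neighbours of `w` are adjacent to both or neither, which `lopsided` excludes.
      single-exit : ∀ {w p} → Common u v w → Adj G w p → ¬ Adj T v p
      single-exit {w} {p} (uw , vw) wp vp = [ exit-v , exit-u ]′ (split vp)
        where
        p-off : Off u v p
        p-off = ≢u′ vp , ≢-sym (Adj⇒≢ T vp)

        w-off : Off u v w
        w-off = ≢-sym (Adj⇒≢ G uw) , ≢-sym (Adj⇒≢ G vw)

        unique-exit : ∀ {x} → x ≢ p → Off u v x → Adj G w x → ¬ Adj T v x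
        unique-exit x≢p x-off wx vx = x≢p (no-return T F vx vp
          ((Adj-sym T (away⁺ w-off x-off wx) , proj₂ x-off , proj₂ w-off)
           ◅ return (away⁺ w-off p-off wp , proj₂ w-off , proj₂ p-off)))

        twins : ∀ {x} → x ≢ p → Off u v x → Adj G w x →
                (Adj G u x → Adj G v x) × (Adj G v x → Adj G u x)
        twins {x} x≢p x-off wx with adj? G u x | adj? G v x
        ... | yes ux | yes vx = (λ _ → vx) , (λ _ → ux)
        ... | yes ux | no ¬vx = contradiction (gain (proj₂ x-off) ¬vx ux) (unique-exit x≢p x-off wx)
        ... | no ¬ux | yes vx = contradiction (keep (proj₁ x-off) vx ¬ux) (unique-exit x≢p x-off wx)
        ... | no ¬ux | no ¬vx = (λ ux → contradiction ux ¬ux) , (λ vx → contradiction vx ¬vx)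

        exit-v : ¬ (Adj G v p × ¬ Adj G u p)
        exit-v (vp , ¬up) = lopsided uv (Adj-sym G uw) (Adj-sym G vw) (Adj-sym G wp) vp ¬up
          (proj₁ p-off) twins

        exit-u : ¬ (¬ Adj G v p × Adj G u p)
        exit-u (¬vp , up) = lopsided (Adj-sym G uv) (Adj-sym G vw) (Adj-sym G uw) (Adj-sym G wp) up ¬vp
          (proj₂ p-off) λ x≢p (x≢v , x≢u) wx →
            let f , g = twins x≢p (x≢u , x≢v) wx in g , f

      Free : Fin n → Set
      Free x = Off u v x × ¬ Common u v x

      FreeStep : Fin n → Fin n → Set
      FreeStep x y = Adj G x y × Free x × Free y

      -- If `q` is adjacent to `w`, or `p` to one of `u` and `v`, then `single-exit` applies.
      -- Otherwise `contracted-cycle` does, with whichever of `u` and `v` is adjacent to `q`; a free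
      -- walk misses `w`, which is a common neighbour.
      dead-end : ∀ {w p q} → Common u v w → Adj G w p → Free p → Free q →
                 Star FreeStep p q → ¬ Adj T v q
      dead-end {w} {p} {q} com@(uw , vw) wp ((p≢u , p≢v) , ¬com) ((q≢u , q≢v) , ¬com′) walk vq
        with adj? G w q | adj? G v p | adj? G u p
      ... | yes wq | _      | _      = single-exit com wq vq
      ... | no _   | yes vp | yes up = ¬com (up , vp)
      ... | no _   | yes vp | no ¬up = single-exit com wp (keep p≢u vp ¬up)
      ... | no _   | no ¬vp | yes up = single-exit com wp (gain p≢v ¬vp up)
      ... | no ¬wq | no ¬vp | no ¬up with split vq
      ...   | inj₁ (vq , _) = let _ , iso′ , F′ , _ = trees (Adj-sym G vw) in
        contracted-cycle (Adj-sym G vw) iso′ F′ wp ¬vp p≢v vq ¬wq (λ { refl → ¬com′ com })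
          (map (λ { (e , ((_ , x≢v) , ¬x) , ((_ , y≢v) , ¬y)) →
            e , ((λ { refl → ¬x com }) , x≢v) , ((λ { refl → ¬y com }) , y≢v) }) walk)
      ...   | inj₂ (_ , uq) = let _ , iso′ , F′ , _ = trees (Adj-sym G uw) in
        contracted-cycle (Adj-sym G uw) iso′ F′ wp ¬up p≢u uq ¬wq (λ { refl → ¬com′ com })
          (map (λ { (e , ((x≢u , _) , ¬x) , ((y≢u , _) , ¬y)) →
            e , ((λ { refl → ¬x com }) , x≢u) , ((λ { refl → ¬y com }) , y≢u) }) walk)

      mutual
        -- In `T` the edges `uw` and `vw` cancel, so the walk cannot step from `w` to `v`. The
        -- search restarts at each further common neighbour, so that `w` is the last one when `v` is
        -- reached.
        from-common : ∀ {w} → Common u v w → ¬ Star (Adj T) w v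
        from-common (_ , vw) ε = Adj-irrefl G vw
        from-common {w} com@(uw , vw) (_◅_ {j = x} wx rest) with x ≟ v
        ... | yes refl = [ (λ p → proj₂ p uw) , (λ p → proj₁ p vw) ]′ (split (Adj-sym T wx))
        ... | no x≢v with common? u v x
        ...   | yes com′ = from-common com′ rest
        ...   | no ¬com  = from-free com
                (away⁻ (≢u wx , ≢-sym (Adj⇒≢ G vw)) (≢u′ wx , x≢v) wx)
                ((≢u′ wx , x≢v) , ¬com) ((≢u′ wx , x≢v) , ¬com) ε rest

        from-free : ∀ {w p x} → Common u v w → Adj G w p → Free p → Free x →
                    Star FreeStep p x → ¬ Star (Adj T) x v
        from-free _ _ _ ((_ , v≢v) , _) _ ε = v≢v refl
        from-free com wp p-free x-free walk (_◅_ {j = y} xy rest) with y ≟ v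
        ... | yes refl = dead-end com wp p-free x-free walk (Adj-sym T xy)
        ... | no y≢v with common? u v y
        ...   | yes com′ = from-common com′ rest
        ...   | no ¬com  = from-free com wp p-free y-free
                (walk ◅◅ return (away⁻ (proj₁ x-free) (proj₁ y-free) xy , x-free , y-free)) rest
          where y-free = (≢u′ xy , y≢v) , ¬com

  no-triangle : ∀ {u v w} → Adj G u v → Adj G u w → ¬ Adj G v w
  no-triangle uv uw vw with trees uv
  ... | _ , iso , F , conn = Contracted.from-common uv iso F (uw , vw)
    (conn (≢-sym (Adj⇒≢ G uw)) (≢-sym (Adj⇒≢ G uv)) (Adj-sym G uw) (Adj-sym G uv))

  -- Let `ax` be the first edge of a walk that avoids `ab`. Without triangles, isolating `x`
  -- contracts `ax` and cancels no edges, so the walk is projected to one that avoids `ab` in the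
  -- forest `H`, where `ab` is still an edge.
  forest : Forest G
  forest ab ε = Adj-irrefl G ab
  forest {a} {b} ab (_◅_ {j = x} (ax , x≢b , _) rest) with trees (Adj-sym G ax)
  ... | H , iso , F , _ = F ab′ (project-walk (onto-a (inj₁ refl)) rest)
    where
    open Isolation (Adj-sym G ax) iso

    b≢x : b ≢ x
    b≢x b≡x = x≢b (refl , sym b≡x)

    b-off : Off x a b
    b-off = b≢x , ≢-sym (Adj⇒≢ G ab)

    ab′ : Adj H a b
    ab′ = keep b≢x ab (no-triangle ab ax ∘ Adj-sym G)

    End : Fin n → Set
    End y = y ≡ x ⊎ y ≡ a

    -- The graph of the map that sends x to a and fixes the other vertices.
    data Image : Fin n → Fin n → Set where
      onto-a : ∀ {y} → End y → Image y a
      fixed  : ∀ {y} → Off x a y → Image y y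

    image : ∀ y → ∃ (Image y)
    image y with y ≟ x | y ≟ a
    ... | yes y≡x | _       = a , onto-a (inj₁ y≡x)
    ... | no _    | yes y≡a = a , onto-a (inj₂ y≡a)
    ... | no y≢x  | no y≢a  = y , fixed (y≢x , y≢a)

    leave : ∀ {y z} → End y → Off x a z → Avoid G a b y z → Avoid H a b a z
    leave (inj₁ refl) (_ , z≢a) (xz , _) =
      gain z≢a (λ az → no-triangle ax az xz) xz
      -- If `az` were `ab`, then `a`, `b` and `x` would form a triangle.
      , (λ { (_ , refl) → no-triangle ab ax (Adj-sym G xz) })
      , z≢a ∘ proj₂
    leave (inj₂ refl) (z≢x , z≢a) (az , z≢b , _) =
      keep z≢x az (no-triangle ax az) , z≢b , z≢a ∘ proj₂

    project : ∀ {y y′ z z′} → Image y y′ → Image z z′ →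
              Avoid G a b y z → Star (Avoid H a b) y′ z′
    project (onto-a _)   (onto-a _)   _  = ε
    project (onto-a y)   (fixed z)    yz = return (leave y z yz)
    project (fixed y)    (onto-a z)   yz = return (avoid-sym H (leave z y (avoid-sym G yz)))
    project (fixed y)    (fixed z)    (yz , ≢₁ , ≢₂) = return (away⁺ y z yz , ≢₁ , ≢₂)

    project-walk : ∀ {y y′} → Image y y′ → Star (Avoid G a b) y b → Star (Avoid H a b) y′ b
    project-walk (onto-a b-end) ε = contradiction b-end [ proj₁ b-off , proj₂ b-off ]′
    project-walk (fixed _)      ε = ε
    project-walk y (_◅_ {j = z} yz w) =
      project y (proj₂ (image z)) yz ◅◅ project-walk (proj₂ (image z)) w

-- Induction along isolations

Supports : List (Fin n) → Graph n → Set
Supports vs G = ∀ {a b} → Adj G a b → a ∈ vs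

remove : Fin n → List (Fin n) → List (Fin n)
remove u = filter (¬? ∘ (_≟ u))

∈-remove : ∀ {u a : Fin n} {vs} → a ∈ vs → a ≢ u → a ∈ remove u vs
∈-remove {u = u} = ∈-filter⁺ (¬? ∘ (_≟ u))

length-remove : ∀ {u : Fin n} {vs} → u ∈ vs → length (remove u vs) < length vs
length-remove {u = u} u∈vs = filter-notAll (¬? ∘ (_≟ u)) _ (lose u∈vs (λ u≢u → u≢u refl))

edge? : (G : Graph n) → Dec (∃ λ u → ∃ λ v → Adj G u v)
edge? G = any? λ u → any? λ v → adj? G u v

module _ (G : Graph n) {vs : List (Fin n)} (supports : Supports vs G) where

  -- An edge of the new graph yields a walk in `G` between distinct vertices, so its start has an
  -- edge in `G` too.
  isolate-supports : ∀ {u v} (uv : Adj G u v) → Supports (remove u vs) (isolate G uv)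
  isolate-supports {u} uv e = ∈-remove (start (H⇒walk e) (Adj⇒≢ (isolate G uv) e)) (≢u e)
    where
    open Isolation uv (isolate-isolates G uv)
    start : ∀ {a b} → Star (Adj G) a b → a ≢ b → a ∈ vs
    start ε       a≢a = contradiction refl a≢a
    start (e ◅ _) _   = supports e

  two-supported : ∀ {u v} → Adj G u v → 2 ≤ length vs
  two-supported {u} uv = ≤-trans
    (s≤s (nonempty (∈-remove (supports (Adj-sym G uv)) (≢-sym (Adj⇒≢ G uv)))))
    (length-remove (supports uv))
    where
    nonempty : ∀ {a : Fin n} {ws} → a ∈ ws → 1 ≤ length ws
    nonempty (here _)  = s≤s z≤n
    nonempty (there _) = s≤s z≤n

-- Graphs keep all n vertices, so `vs` acts as the shrinking vertex set: each isolation removes a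
-- vertex from it, and a single vertex carries no edge.
reduction : ∀ k (G : Graph n) {vs} → length vs ≤ suc k → Supports vs G →
            ∃ λ j → j ≤ k × EdgelessAfter j G
reduction k G len supports with edge? G
... | no none = 0 , z≤n , done λ a b ab → none (a , b , ab)
reduction zero G len supports | yes (_ , _ , uv) =
  contradiction (≤-trans (two-supported G supports uv) len) λ { (s≤s ()) }
reduction (suc k) G len supports | yes (_ , _ , uv) =
  let j , j≤k , r = reduction k (isolate G uv) (s≤s⁻¹ (≤-trans (length-remove (supports uv)) len))
                                (isolate-supports G supports uv)
  in suc j , s≤s j≤k , step (isolating G uv) r

-- A reduction of an isolation is prolonged by one reflection to a reduction of `G`, so the lower
-- bound passes to every isolation with `k` lowered by one. By induction all of them are trees, and
-- `NoTriangle` applies.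
slow⇒tree : ∀ k (G : Graph n) {vs} → length vs ≤ suc k → Supports vs G →
            (∀ j → EdgelessAfter j G → k ≤ j) →
            (∀ {a b} → a ∈ vs → b ∈ vs → Star (Adj G) a b) × Forest G
slow⇒tree k G len supports slow with edge? G
slow⇒tree zero G len supports slow | yes (_ , _ , uv) =
  contradiction (≤-trans (two-supported G supports uv) len) λ { (s≤s ()) }
slow⇒tree k G len supports slow | no none =
  joined k len k≤0 , λ {a} {b} ab → contradiction (a , b , ab) none
  where
  -- Zero reflections suffice here, so `k` is 0 and `vs` has at most one vertex.
  k≤0 : k ≤ 0
  k≤0 = slow 0 (done λ a b ab → none (a , b , ab))

  joined : ∀ k {ws} → length ws ≤ suc k → k ≤ 0 → ∀ {a b} → a ∈ ws → b ∈ ws → Star (Adj G) a b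
  joined zero {_ ∷ []}    _         _ (here refl) (here refl) = ε
  joined zero {_ ∷ _ ∷ _} (s≤s ()) _
slow⇒tree (suc k) G {vs} len supports slow | yes (u , v , uv) =
  (λ a∈ b∈ → to-v a∈ ◅◅ reverse (Adj-sym G) (to-v b∈)) , NoTriangle.forest G trees
  where
  isolated-tree : ∀ {u v} (uv : Adj G u v) →
    (∀ {a b} → a ∈ remove u vs → b ∈ remove u vs → Star (Adj (isolate G uv)) a b) ×
    Forest (isolate G uv)
  isolated-tree uv = slow⇒tree k (isolate G uv) (s≤s⁻¹ (≤-trans (length-remove (supports uv)) len))
    (isolate-supports G supports uv)
    (λ j r → s≤s⁻¹ (slow (suc j) (step (isolating G uv) r)))

  trees : IsolationsAreTrees G
  trees uv = isolate G uv , isolate-isolates G uv , proj₂ (isolated-tree uv)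
    , λ a≢u b≢u ac bd → proj₁ (isolated-tree uv)
        (∈-remove (supports ac) a≢u) (∈-remove (supports bd) b≢u)

  open Isolation uv (isolate-isolates G uv) using (H⇒walk)

  to-v : ∀ {a} → a ∈ vs → Star (Adj G) a v
  to-v {a} a∈ with a ≟ u
  ... | yes refl = return uv
  ... | no  a≢u  = kleisliStar id H⇒walk (proj₁ (isolated-tree uv)
    (∈-remove a∈ a≢u) (∈-remove (supports (Adj-sym G uv)) (≢-sym (Adj⇒≢ G uv))))

theorem4p3p4 : ∀ (n : ℕ) .{{_ : NonZero n}} (G : Graph n) →
    RequiresExactly G (n ∸ 1) ⇔ IsTree G
theorem4p3p4 (suc m) G = mk⇔ to-tree from-tree
  where
  len : length (allFin (suc m)) ≤ suc m
  len = ≤-reflexive (length-tabulate {n = suc m} (λ x → x))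

  supports : Supports (allFin (suc m)) G
  supports {a} _ = ∈-allFin a

  to-tree : RequiresExactly G m → IsTree G
  to-tree (_ , slow) =
    let conn , F = slow⇒tree m G len supports slow
    in (λ a b → conn (∈-allFin a) (∈-allFin b)) , forest⇒acyclic F

  from-tree : IsTree G → RequiresExactly G m
  from-tree (conn , acyclic) with reduction m G len supports
  -- The reduction found might be shorter than `m`; the lower bound shows that its length is `m`.
  ... | j , j≤m , r = subst (λ k → EdgelessAfter k G) (≤-antisym j≤m (bound j r)) r , bound
    where
    bound : ∀ j → EdgelessAfter j G → m ≤ j
    bound j r = s≤s⁻¹ (subst (λ k → suc m ≤ suc k) (+-identityʳ j)
      (forest-lower-bound (acyclic⇒forest acyclic) (connected⇒connectedBy {G = G} conn) r))
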